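{- Let $a$ be an unrestricted program constant. Let $A=p_A(\bar{ch},\bar y)$, $A_i=p_{A_i}(\bar{ch},\bar y)$, $C_i=p_{C_i}(\bar{ch},\bar y)$ ($i=1,2$) and $P=p_P(\bar{ch},\bar z)$ be atomic formulas, built from predicate symbols annotated with a (co)finite channel set $\bar{ch}$ and applied to vectors of variables, where $\bar y$ consists of trace variables. Let $\chi\equiv(A\wedge C_1\to A_2)\wedge(A\wedge C_2\to A_1)$. Then the formula $$[a]\{\mathit{true},\chi\}\mathit{true}\;\wedge\;[a]\{A_1\wedge A_2,\,C_1\wedge C_2\}P\;\to\;[a]\{A,\,C_1\wedge C_2\}P$$ is valid, i.e. true in every interpretation and state.
   Context: Setting (dLCHP). Variables and channels. $\mathcal V=\mathcal V_{\mathbb R}\cup\mathcal V_{\mathbb N}\cup\mathcal V_{\mathcal T}$ are real, integer and trace variables; $\Omega$ is the set of channel names. Traces and states. - A trace is a finite sequence of events $\langle ch,d,s\rangle$ with $ch\in\Omega$ and $d,s\in\mathbb R$. A recorded trace additionally tags each event with a trace variable. - $\epsilon$ is the empty trace; $\preceq$ is prefix and $\prec$ is strict prefix. - A state maps each variable to a value of its type. - $v\cdot\tau$ appends to each trace variable $h$ of state $v$ the subsequence of events of $\tau$ tagged with $h$. - $v\downarrow C$ projects the value of every trace variable onto the events with channel in $C$. Interpretations. An interpretation $I$ assigns relations to predicate symbols, and to the unrestricted program constant $a$ a prefix-closed set $[\![a]\!]^I$ of computations $(v,\tau,w)$ (state $v$, recorded trace $\tau$, final state $w$ or $\bot$) containing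 every $(v,\epsilon,\bot)$, with $v=w$ on trace variables. Prefix-closed means: if $(v,\tau,w)\in[\![a]\!]^I$ and $\tau'\preceq\tau$, then $(v,\tau',\bot)\in[\![a]\!]^I$. Formula semantics. - $I,v\models p(\bar{ch},\bar x)$ iff the values of $\bar x$ in $v\downarrow\bar{ch}$ lie in $I(p)$; propositional connectives are classical. - $I,v\models[a]\{A,C\}\psi$ iff for all $(v,\tau,w)\in[\![a]\!]^I$ both hold: - (commit) if $I,v\cdot\sigma\models A$ for all $\sigma\prec\tau$, then $I,v\cdot\tau\models C$; - (post) if $I,v\cdot\sigma\models A$ for all $\sigma\preceq\tau$ and $w\neq\bot$, then $I,w\cdot\tau\models\psi$. -}

module Defs where

open import Algebra.Structures using (IsCommutativeRing)
open import Data.List using (List; _++_; map; filter)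
open import Data.List.Membership.Propositional using (_∈_; _∉_)
open import Data.List.Relation.Binary.Prefix.Heterogeneous using (Prefix)
open import Data.List.Relation.Unary.All as All using (All)
open import Data.List.Relation.Unary.Any using (any?)
open import Data.Maybe using (Maybe; just; nothing)
open import Data.Nat using (ℕ)
open import Data.Product using (_×_; proj₁; proj₂; Σ-syntax; ∃-syntax)
open import Data.Unit using (⊤)
open import Relation.Binary.Definitions using (DecidableEquality)
open import Relation.Binary.PropositionalEquality using (_≡_; _≢_)
open import Relation.Binary.Structures using (IsTotalOrder)
open import Relation.Nullary using (¬_; Dec; ¬?)

-- ℝ is axiomatised as a Dedekind-complete ordered field.
record RealNumbers : Set₁ where
  infixl 6 _+_
  infixl 7 _*_
  infix  4 _≤_
  field
    ℝ    : Set
    _+_  : ℝ → ℝ → ℝ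
    _*_  : ℝ → ℝ → ℝ
    -_   : ℝ → ℝ
    0ℝ   : ℝ
    1ℝ   : ℝ
    _≤_  : ℝ → ℝ → Set

    isCommutativeRing : IsCommutativeRing _≡_ _+_ _*_ -_ 0ℝ 1ℝ
    0≢1               : 0ℝ ≢ 1ℝ
    inverse           : ∀ x → x ≢ 0ℝ → ∃[ y ] x * y ≡ 1ℝ

    isTotalOrder : IsTotalOrder _≡_ _≤_
    +-mono-≤     : ∀ x {y z} → y ≤ z → x + y ≤ x + z
    *-nonNeg     : ∀ {x y} → 0ℝ ≤ x → 0ℝ ≤ y → 0ℝ ≤ x * y

  UpperBound : (ℝ → Set) → ℝ → Set
  UpperBound S u = ∀ x → S x → x ≤ u

  field
    supremum : (S : ℝ → Set) → ∃[ x ] S x → ∃[ u ] UpperBound S u →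
               Σ[ s ∈ ℝ ] (UpperBound S s × (∀ u → UpperBound S u → s ≤ u))

data Sort : Set where
  real integer trace : Sort

-- Predicate symbols are indexed by the sorts of their arguments.  Names of
-- channels and trace variables can be compared, as projection requires.
record Signature : Set₁ where
  field
    Channel   : Set
    _≟ᶜ_      : DecidableEquality Channel
    Var       : Sort → Set
    _≟ᵗ_      : DecidableEquality (Var trace)
    Predicate : List Sort → Set
    Program   : Set

module DLCHP (R : RealNumbers) (S : Signature) where

  open RealNumbers R using (ℝ)
  open Signature S

  data ChannelSet : Set where
    finite   : List Channel → ChannelSet
    cofinite : List Channel → ChannelSet

  infix 4 _∈ᶜ_ _∈ᶜ?_

  _∈ᶜ_ : Channel → ChannelSet → Set
  c ∈ᶜ finite cs   = c ∈ cs
  c ∈ᶜ cofinite cs = c ∉ cs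

  _∈ᶜ?_ : ∀ c C → Dec (c ∈ᶜ C)
  c ∈ᶜ? finite cs   = any? (c ≟ᶜ_) cs
  c ∈ᶜ? cofinite cs = ¬? (any? (c ≟ᶜ_) cs)

  record Event : Set where
    constructor event
    field
      ch : Channel
      d  : ℝ
      s  : ℝ

  Trace : Set
  Trace = List Event

  RecordedTrace : Set
  RecordedTrace = List (Var trace × Event)

  infix 4 _⪯_ _≺_

  _⪯_ : RecordedTrace → RecordedTrace → Set
  _⪯_ = Prefix _≡_

  _≺_ : RecordedTrace → RecordedTrace → Set
  σ ≺ τ = σ ⪯ τ × σ ≢ τ

  Value : Sort → Set
  Value real    = ℝ
  Value integer = ℕ
  Value trace   = Trace

  State : Set
  State = (s : Sort) → Var s → Value s

  infixl 6 _·_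
  infixl 6 _↓_

  _·_ : State → RecordedTrace → State
  (v · τ) real    x = v real x
  (v · τ) integer n = v integer n
  (v · τ) trace   h = v trace h ++ map proj₂ (filter (λ e → h ≟ᵗ proj₁ e) τ)

  _↓_ : State → ChannelSet → State
  (v ↓ C) real    x = v real x
  (v ↓ C) integer n = v integer n
  (v ↓ C) trace   h = filter (λ e → Event.ch e ∈ᶜ? C) (v trace h)

  -- Final states are Maybe State, with nothing for the unfinished state ⊥.
  record Interpretation : Set₁ where
    field
      ⟦_⟧ᵖ : ∀ {Γ} → Predicate Γ → All Value Γ → Set
      ⟦_⟧  : Program → State → RecordedTrace → Maybe State → Set

      total           : ∀ a v → ⟦ a ⟧ v List.[] nothing
      prefix-closed   : ∀ a {v τ w τ′} → ⟦ a ⟧ v τ w → τ′ ⪯ τ →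
                        ⟦ a ⟧ v τ′ nothing
      preserves-trace : ∀ a {v τ w} → ⟦ a ⟧ v τ (just w) →
                        ∀ h → v trace h ≡ w trace h

  infixr 7 _∧_
  infixr 6 _⇒_
  infix  8 not_
  infix  8 [_]⟪_,_⟫_

  -- [ a ]⟪ A , C ⟫ ψ is the ac-box [a]{A,C}ψ.
  data Formula : Set where
    atom       : ∀ {Γ} → Predicate Γ → ChannelSet → All Var Γ → Formula
    true       : Formula
    not_       : Formula → Formula
    _∧_        : Formula → Formula → Formula
    _⇒_        : Formula → Formula → Formula
    [_]⟪_,_⟫_  : Program → Formula → Formula → Formula → Formula

  infix 4 _∣_⊨_

  _∣_⊨_ : Interpretation → State → Formula → Set
  I ∣ v ⊨ atom p C xs        = Interpretation.⟦_⟧ᵖ I p (All.map (λ {s} → (v ↓ C) s) xs)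
  I ∣ v ⊨ true               = ⊤
  I ∣ v ⊨ not φ              = ¬ (I ∣ v ⊨ φ)
  I ∣ v ⊨ φ ∧ ψ              = (I ∣ v ⊨ φ) × (I ∣ v ⊨ ψ)
  I ∣ v ⊨ φ ⇒ ψ              = I ∣ v ⊨ φ → I ∣ v ⊨ ψ
  I ∣ v ⊨ [ a ]⟪ A , C ⟫ ψ   =
    ∀ τ w → Interpretation.⟦_⟧ I a v τ w →
      ((∀ σ → σ ≺ τ → I ∣ v · σ ⊨ A) → I ∣ v · τ ⊨ C)
      ×
      ((∀ σ → σ ⪯ τ → I ∣ v · σ ⊨ A) →
        ∀ w′ → w ≡ just w′ → I ∣ w′ · τ ⊨ ψ)

  Valid : Formula → Set₁
  Valid φ = ∀ I v → I ∣ v ⊨ φ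

{-# OPTIONS --safe #-}
module Submission where

-- A shortest prefix of the trace at which A₁ ∧ A₂ fails cannot exist: A₁ ∧ A₂
-- holds strictly before it, so the second box commits to C₁ ∧ C₂ at it, and
-- with A the compositionality condition χ turns these into A₂ and A₁.  Hence A
-- along a computation already implies A₁ ∧ A₂ along it.

open import Data.Empty using (⊥-elim)
open import Data.List using (List; []; _∷_; length; replicate)
open import Data.List.Relation.Binary.Prefix.Heterogeneous using ([]; _∷_)
open import Data.List.Relation.Binary.Prefix.Heterogeneous.Properties using () renaming (trans to prefix-trans)
open import Data.List.Relation.Unary.All using (All)
open import Data.Maybe using (nothing)
open import Data.Nat using (ℕ; _<_; z<s; s<s)
open import Data.Nat.Induction using (<-wellFounded)
open import Data.Product using (_,_; proj₁; proj₂)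
open import Data.Unit using (tt)
open import Function using (_on_)
open import Induction.WellFounded using (WellFounded; module All; module Subrelation)
open import Relation.Binary.Construct.On using () renaming (wellFounded to on-wellFounded)
open import Relation.Binary.PropositionalEquality using (_≡_; refl; trans; cong)
open import Defs

module _ (R : RealNumbers) (S : Signature) where

  open Signature S
  open DLCHP R S

  ⪯-refl : ∀ {τ} → τ ⪯ τ
  ⪯-refl {[]}    = []
  ⪯-refl {_ ∷ _} = refl ∷ ⪯-refl

  ⪯-trans : ∀ {ρ σ τ} → ρ ⪯ σ → σ ⪯ τ → ρ ⪯ τ
  ⪯-trans = prefix-trans trans

  ⪯-antisym : ∀ {σ τ} → σ ⪯ τ → τ ⪯ σ → σ ≡ τ
  ⪯-antisym []         []         = refl
  ⪯-antisym (refl ∷ p) (_ ∷ q) = cong (_ ∷_) (⪯-antisym p q)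

  ⪯-≺-trans : ∀ {ρ σ τ} → ρ ⪯ σ → σ ≺ τ → ρ ≺ τ
  ⪯-≺-trans ρ⪯σ (σ⪯τ , σ≢τ) =
    ⪯-trans ρ⪯σ σ⪯τ , λ { refl → σ≢τ (⪯-antisym σ⪯τ ρ⪯σ) }

  -- Supplies the measure on which the induction over prefixes descends.
  ≺⇒length< : ∀ {σ τ} → σ ≺ τ → length σ < length τ
  ≺⇒length< {τ = []}    ([]       , σ≢τ) = ⊥-elim (σ≢τ refl)
  ≺⇒length< {τ = _ ∷ _} ([]       , _)   = z<s
  ≺⇒length<             (refl ∷ p , σ≢τ) =
    s<s (≺⇒length< (p , λ eq → σ≢τ (cong (_ ∷_) eq)))

  ≺-wellFounded : WellFounded _≺_
  ≺-wellFounded =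
    Subrelation.wellFounded {_<₂_ = _<_ on length} ≺⇒length< (on-wellFounded length <-wellFounded)

  module _ (a : Program) (A A₁ A₂ C₁ C₂ : Formula) where

    χ : Formula
    χ = ((A ∧ C₁) ⇒ A₂) ∧ ((A ∧ C₂) ⇒ A₁)

    module _ (I : Interpretation) (v : State) (P : Formula)
             (compositional : I ∣ v ⊨ [ a ]⟪ true , χ ⟫ true)
             (box           : I ∣ v ⊨ [ a ]⟪ A₁ ∧ A₂ , C₁ ∧ C₂ ⟫ P)
      where

      open Interpretation I

      -- With `nothing` as final state, this applies to every prefix of any run, by prefix closure.
      -- `A` is required at `σ` itself because `χ` is used there.
      assumption-transfer : ∀ σ → ⟦ a ⟧ v σ nothing →
                            (∀ ρ → ρ ⪯ σ → I ∣ v · ρ ⊨ A) →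
                            I ∣ v · σ ⊨ A₁ ∧ A₂
      assumption-transfer = All.wfRec ≺-wellFounded _ _ step
        where
        step : ∀ σ → _ → _
        -- The roles cross: `C₂` yields `A₁`, and `C₁` yields `A₂`.
        step σ ih run hA = proj₂ χσ (hA σ ⪯-refl , proj₂ Cσ)
                         , proj₁ χσ (hA σ ⪯-refl , proj₁ Cσ)
          where
          χσ : I ∣ v · σ ⊨ χ
          χσ = proj₁ (compositional σ nothing run) (λ _ _ → tt)

          Cσ : I ∣ v · σ ⊨ C₁ ∧ C₂
          -- Not circular: committing at `σ` asks for `A₁ ∧ A₂` only at strict prefixes, which `ih`
          -- covers.
          Cσ = proj₁ (box σ nothing run) λ ρ (ρ⪯σ , ρ≢σ) →
            ih (ρ⪯σ , ρ≢σ) (prefix-closed a run ρ⪯σ)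
               (λ π π⪯ρ → hA π (⪯-trans π⪯ρ ρ⪯σ))

      parallel-assumption : I ∣ v ⊨ [ a ]⟪ A , C₁ ∧ C₂ ⟫ P
      parallel-assumption τ w run =
          -- Commit: `A` is known only strictly before `τ`, and each prefix of a strict prefix `σ`
          -- still lies there.
          (λ hA → proj₁ (box τ w run) λ σ σ≺τ →
            assumption-transfer σ (prefix-closed a run (proj₁ σ≺τ))
              (λ ρ ρ⪯σ → hA ρ (⪯-≺-trans ρ⪯σ σ≺τ)))
        -- Post: here `σ` may be `τ`; prefix closure then replaces the final state `w` by `nothing`.
        , (λ hA → proj₂ (box τ w run) λ σ σ⪯τ →
            assumption-transfer σ (prefix-closed a run σ⪯τ)
              (λ ρ ρ⪯σ → hA ρ (⪯-trans ρ⪯σ σ⪯τ)))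

theorem3 :
  (R : RealNumbers) (S : Signature) →
  let open Signature S
      open DLCHP R S
  in
  (a : Program) (ch : ChannelSet)
  (n : ℕ) (y : All Var (replicate n trace))
  (Γ : List Sort) (z : All Var Γ)
  (pA pA₁ pA₂ pC₁ pC₂ : Predicate (replicate n trace)) (pP : Predicate Γ) →
  let A  = atom pA ch y
      A₁ = atom pA₁ ch y
      A₂ = atom pA₂ ch y
      C₁ = atom pC₁ ch y
      C₂ = atom pC₂ ch y
      P  = atom pP ch z
      χ  = ((A ∧ C₁) ⇒ A₂) ∧ ((A ∧ C₂) ⇒ A₁)
  in
  Valid ((([ a ]⟪ true , χ ⟫ true) ∧ ([ a ]⟪ A₁ ∧ A₂ , C₁ ∧ C₂ ⟫ P)) ⇒ ([ a ]⟪ A , C₁ ∧ C₂ ⟫ P))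
theorem3 R S a ch n y Γ z pA pA₁ pA₂ pC₁ pC₂ pP I v (compositional , box) =
  parallel-assumption R S a (atom pA ch y) (atom pA₁ ch y) (atom pA₂ ch y) (atom pC₁ ch y) (atom pC₂ ch y)
    I v (atom pP ch z) compositional box
  where open DLCHP R S
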